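{- Let $p\ge1$ and $\ell\ge1$. There is a constant $\alpha$, depending only on $p$ and $\ell$, such that, with respect to item access level interleaving in the linearization-based model, for any request sequences $\sigma_1,\dots,\sigma_p$ to a list of $\ell$ items and any execution $\epsilon$ of DMTF on $\sigma_1,\dots,\sigma_p$, $$\mathrm{DMTF}(\epsilon)\le(p+1)\,\mathrm{OPT}\bigl(\mathrm{Lin}_\epsilon(\sigma_1,\dots,\sigma_p)\bigr)+\alpha.$$
   Context: List Accessing: a list of $\ell$ distinct items is maintained in some order, starting from a fixed initial order. A request is an item of the list. A sequential algorithm serves a request by searching from the front of the list; the cost is the index (position, starting at $1$) of the item. After the access, the item may be moved, free of charge, to any location closer to the front. (Paid exchanges, which switch two adjacent items at cost $1$, are also allowed.) For a request sequence $M$, $\mathrm{OPT}(M)$ denotes the minimum total cost of an offline sequential algorithm (knowing all of $M$) serving the requests of $M$ in order. There are $p$ processes, the $i$th having its own finite request sequence $\sigma_i$, which it must serve in order. DMTF is the distributed Move-to-Front algorithm: each item found is moved to the front of the list. Item access level interleaving: several processes may be searching for the same item at the same time. All requests to an item $x$ that are concurrent in this sense (one process finds $x$ and moves it to the front, and the others started their search for $x$ before this move and finish it after the move) are assumed to find $x$ in the same location and to have the same cost. These concurrent requests are linearized as successive requests to $x$, when $x$ is at the front of the list, so that the list order during any execution is the same as if sequential Move-to-Front were run on the linearized sequence. For an execution $\epsilon$ of DMTF on $\sigma_1,\dots,\sigma_p$, $\mathrm{Lin}_\epsilon(\sigma_1,\dots,\sigma_p)$ denotes the sequence of requests in the order in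 which they are linearized; it is an interleaving of $\sigma_1,\dots,\sigma_p$ respecting the order of each. At the item access level, an execution $\epsilon$ thus corresponds to this sequence together with a division of it into consecutive groups, each group consisting of (concurrent) requests to one and the same item made by distinct processes; if the item is at position $i$ of the list when the group is served, each request of the group has cost $i$, and then the item is moved to the front. $\mathrm{DMTF}(\epsilon)$ is the total cost of all requests in $\epsilon$ (only accesses of nodes while searching through the list are counted). DMTF and OPT start from the same initial list. In the linearization-based model OPT serves, sequentially, the requests in the order $\mathrm{Lin}_\epsilon(\sigma_1,\dots,\sigma_p)$. -}

module Defs where

open import Data.Fin using (Fin; _≟_)
open import Data.List using (List; []; _∷_; _++_; length; map; filter; takeWhile; concatMap; allFin)
open import Data.List.Membership.Propositional using (_∈_)
open import Data.List.Membership.Propositional.Properties using (∈-∃++; ∈-allFin)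
open import Data.List.NonEmpty as List⁺ using (List⁺)
open import Data.List.Relation.Binary.Permutation.Propositional using (_↭_; ↭-sym)
open import Data.List.Relation.Binary.Permutation.Propositional.Properties using (∈-resp-↭)
open import Data.List.Relation.Unary.Unique.Propositional using (Unique)
open import Data.Nat using (ℕ; zero; suc; _+_; _*_; _≤_; _<_; z≤n; s≤s; s≤s⁻¹)
import Data.Nat as ℕ
open import Data.Nat.Properties using (≤-trans; m≤m+n; m≤n+m; m≤n⇒∃[o]m+o≡n; +-cancelˡ-≡; n<1+n)
open import Data.Product using (∃; ∃₂; _×_; _,_; proj₁; proj₂)
open import Data.Sum using (_⊎_; inj₁; inj₂)
open import Function using (_∘_)
open import Relation.Binary.PropositionalEquality using (_≡_; refl)
open import Relation.Nullary using (Dec; yes; no; contradiction)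
open import Relation.Nullary.Decidable using (¬?; map′; _⊎-dec_)

private
  variable
    p ℓ : ℕ

record Order (ℓ : ℕ) : Set where
  field
    items       : List (Fin ℓ)
    arrangement : items ↭ allFin ℓ

open Order public

private
  variable
    L L′ : List (Fin ℓ)
    M    : List (Fin ℓ)
    x y  : Fin ℓ
    c    : ℕ

-- Positions start at 1; the value is meaningful only if x occurs in L.
position : Fin ℓ → List (Fin ℓ) → ℕ
position x L = suc (length (takeWhile (λ y → ¬? (y ≟ x)) L))

moveToFront : Fin ℓ → List (Fin ℓ) → List (Fin ℓ)
moveToFront x L = x ∷ filter (λ y → ¬? (y ≟ x)) L

data Exchange {ℓ} : List (Fin ℓ) → List (Fin ℓ) → Set where
  exchange : ∀ as x y bs → Exchange (as ++ x ∷ y ∷ bs) (as ++ y ∷ x ∷ bs)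

-- Forward x L L′: x moves from its place in L to any place closer to the front
-- (as′ nonempty) or stays where it is (as′ empty).
data Forward {ℓ} (x : Fin ℓ) : List (Fin ℓ) → List (Fin ℓ) → Set where
  forward : ∀ as as′ bs → Forward x (as ++ as′ ++ x ∷ bs) (as ++ x ∷ as′ ++ bs)

-- Serves L M c: some offline sequential algorithm, started on the list L,
-- serves the requests M in order at total cost c.
data Serves {ℓ} : List (Fin ℓ) → List (Fin ℓ) → ℕ → Set where
  done   : Serves L [] 0
  paid   : Exchange L L′ → Serves L′ M c → Serves L M (1 + c)
  access : Forward x L L′ → Serves L′ M c → Serves L (x ∷ M) (position x L + c)

-- The minimum cost exists: Serves L M c is decidable, because every operation
-- costs at least 1, and it holds for some c.

private
  split? : ∀ {A : Set} {P : List A → List A → Set} →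
           (∀ as bs → Dec (P as bs)) →
           ∀ L → Dec (∃₂ λ as bs → as ++ bs ≡ L × P as bs)
  split? P? []      = map′ (λ h → [] , [] , refl , h)
                           (λ { ([] , [] , refl , h) → h }) (P? [] [])
  split? P? (z ∷ L) = map′
    (λ { (inj₁ h) → [] , z ∷ L , refl , h
       ; (inj₂ (as , bs , refl , h)) → z ∷ as , bs , refl , h })
    (λ { ([] , _ , refl , h) → inj₁ h
       ; (_ ∷ as , bs , refl , h) → inj₂ (as , bs , refl , h) })
    (P? [] (z ∷ L) ⊎-dec split? (λ as bs → P? (z ∷ as) bs) L)

  module _ {ℓ} {Q : List (Fin ℓ) → Set} (Q? : ∀ L → Dec (Q L)) where

    exchange? : ∀ L → Dec (∃ λ L′ → Exchange L L′ × Q L′)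
    exchange? L = map′
      (λ { (as , _ , refl , x , y , bs , refl , q) → _ , exchange as x y bs , q })
      (λ { (_ , exchange as x y bs , q) → as , _ , refl , x , y , bs , refl , q })
      (split? swap? L)
      where
      swap? : ∀ as zs → Dec (∃ λ x → ∃₂ λ y bs → zs ≡ x ∷ y ∷ bs × Q (as ++ y ∷ x ∷ bs))
      swap? as []           = no λ { (_ , _ , _ , () , _) }
      swap? as (_ ∷ [])     = no λ { (_ , _ , _ , () , _) }
      swap? as (x ∷ y ∷ bs) = map′
        (λ q → x , y , bs , refl , q)
        (λ { (_ , _ , _ , refl , q) → q })
        (Q? (as ++ y ∷ x ∷ bs))

    forward? : ∀ x L → Dec (∃ λ L′ → Forward x L L′ × Q L′)
    forward? x L = map′
      (λ { (as , _ , refl , as′ , _ , refl , bs , refl , q) → _ , forward as as′ bs , q })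
      (λ { (_ , forward as as′ bs , q) → as , _ , refl , as′ , _ , refl , bs , refl , q })
      (split? (λ as → split? (pick? as)) L)
      where
      pick? : ∀ as as′ zs → Dec (∃ λ bs → zs ≡ x ∷ bs × Q (as ++ x ∷ as′ ++ bs))
      pick? as as′ []       = no λ { (_ , () , _) }
      pick? as as′ (z ∷ bs) with z ≟ x
      ... | no z≢x   = no λ { (_ , refl , _) → z≢x refl }
      ... | yes refl = map′ (λ q → bs , refl , q) (λ { (_ , refl , q) → q })
                            (Q? (as ++ x ∷ as′ ++ bs))

  AccessStep : List (Fin ℓ) → List (Fin ℓ) → ℕ → Set
  AccessStep L []      c = c ≡ 0
  AccessStep L (x ∷ M) c = ∃ λ d → position x L + d ≡ c ×
                           (∃ λ L′ → Forward x L L′ × Serves L′ M d)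

  -- The first argument bounds the cost.
  serves? : ∀ n (L M : List (Fin ℓ)) c → c < n → Dec (Serves L M c)
  serves? (suc n) L []      zero    _   = yes done
  serves? (suc n) L (x ∷ M) zero    _   = no λ ()
  serves? (suc n) L M       (suc c) c<n = map′
    (λ { (inj₁ (_ , e , s)) → paid e s ; (inj₂ h) → from M h })
    (λ s → to s refl)
    (exchange? (λ L′ → serves? n L′ M c (s≤s⁻¹ c<n)) L ⊎-dec access? M)
    where
    from : ∀ M → AccessStep L M (suc c) → Serves L M (suc c)
    from (x ∷ M) (d , refl , _ , f , s) = access f s

    to : ∀ {M k} → Serves L M k → k ≡ suc c →
         (∃ λ L′ → Exchange L L′ × Serves L′ M c) ⊎ AccessStep L M (suc c)
    to done           ()
    to (paid e s)     refl = inj₁ (_ , e , s)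
    to (access f s)   eq   = inj₂ (_ , eq , _ , f , s)

    access? : ∀ M → Dec (AccessStep L M (suc c))
    access? []      = no λ ()
    access? (x ∷ M) with position x L ℕ.≤? suc c
    ... | no  i≰c = no λ { (d , refl , _) → i≰c (m≤m+n (position x L) d) }
    ... | yes i≤c with m≤n⇒∃[o]m+o≡n i≤c
    ...   | d , refl = map′
      (λ h → d , refl , h)
      (λ { (d′ , eq , h) → cast (+-cancelˡ-≡ (position x L) d′ d eq) h })
      (forward? (λ L′ → serves? n L′ M d (≤-trans (s≤s (m≤n+m d _)) (s≤s⁻¹ c<n))) x L)
      where
      cast : ∀ {d′} → d′ ≡ d →
             (∃ λ L′ → Forward x L L′ × Serves L′ M d′) →
             (∃ λ L′ → Forward x L L′ × Serves L′ M d)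
      cast refl h = h

  servable : ∀ (L : List (Fin ℓ)) → (∀ x → x ∈ L) → ∀ M → ∃ (Serves L M)
  servable L all []      = 0 , done
  servable L all (x ∷ M) with ∈-∃++ (all x) | servable L all M
  ... | as , bs , refl | c , s = _ , access (forward as [] bs) s

  least : {P : ℕ → Set} → (∀ n → Dec (P n)) → ∀ k → P k →
          ∃ λ m → P m × (∀ n → P n → m ≤ n)
  least P? zero    h = 0 , h , λ _ _ → z≤n
  least P? (suc k) h with P? 0
  ... | yes h₀ = 0 , h₀ , λ _ _ → z≤n
  ... | no ¬h₀ with least (P? ∘ suc) k h
  ...   | m , hm , min = suc m , hm , λ { zero h₀ → contradiction h₀ ¬h₀
                                        ; (suc n) hn → s≤s (min n hn) }

optimum : (L₀ : Order ℓ) (M : List (Fin ℓ)) →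
          ∃ λ c → Serves (items L₀) M c × (∀ c′ → Serves (items L₀) M c′ → c ≤ c′)
optimum L₀ M =
  let all     = λ x → ∈-resp-↭ (↭-sym (arrangement L₀)) (∈-allFin x)
      (k , s) = servable (items L₀) all M
  in least (λ c → serves? (suc c) (items L₀) M c (n<1+n c)) k s

OPT : Order ℓ → List (Fin ℓ) → ℕ
OPT L₀ M = proj₁ (optimum L₀ M)

-- Concurrent requests to one item, in the order in which they are linearized.
record Group (p ℓ : ℕ) : Set where
  field
    item      : Fin ℓ
    processes : List⁺ (Fin p)
    distinct  : Unique (List⁺.toList processes)

open Group public

linearize : List (Group p ℓ) → List (Fin p × Fin ℓ)
linearize = concatMap λ g → map (_, item g) (List⁺.toList (processes g))

requestsOf : Fin p → List (Fin p × Fin ℓ) → List (Fin ℓ)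
requestsOf i = map proj₂ ∘ filter (λ r → proj₁ r ≟ i)

-- A linearized request sequence divided into consecutive groups, whose
-- restriction to each process i is σ i.
record Execution (σ : Fin p → List (Fin ℓ)) : Set where
  field
    groups     : List (Group p ℓ)
    interleave : ∀ i → requestsOf i (linearize groups) ≡ σ i

open Execution public

Lin : {σ : Fin p → List (Fin ℓ)} → Execution σ → List (Fin ℓ)
Lin ε = map proj₂ (linearize (groups ε))

groupsCost : List (Fin ℓ) → List (Group p ℓ) → ℕ
groupsCost L []       = 0
groupsCost L (g ∷ gs) =
  List⁺.length (processes g) * position (item g) L + groupsCost (moveToFront (item g) L) gs

DMTF : Order ℓ → {σ : Fin p → List (Fin ℓ)} → Execution σ → ℕ
DMTF L₀ ε = groupsCost (items L₀) (groups ε)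

{-# OPTIONS --safe #-}

-- The amortized bound holds with α = 0. Let the potential be p times the number of
-- inversions between DMTF's list D and OPT's list L. Consider a group of r ≤ p
-- requests to x. Charge DMTF's part of the group at once: the items that precede x
-- in D but not in L are paid for by the inversions that disappear, which leaves r
-- times the position of x in L. Until OPT has served the last request of the group,
-- count only the inversions not involving x. OPT's first access to x costs at least
-- its position in L, and this, times p + 1, pays for all that remains: r times that
-- position and, if it is the last of the group, p for every item still in front of x.
module Submission where

open import Defs
open import Data.Fin using (Fin; zero; suc; _≟_)
open import Data.Fin.Properties using (injective⇒≤)
open import Data.List using (List; []; _∷_; _++_; length; map; filter; takeWhile; lookup)
open import Data.List.Membership.Propositional using (_∈_)
open import Data.List.Membership.Propositional.Properties
  using (∈-++⁺ʳ; ∈-filter⁺; ∈-lookup)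
open import Data.List.NonEmpty using (_∷_)
open import Data.List.Properties
  using (filter-all; filter-accept; filter-reject; filter-idem; filter-++)
open import Data.List.Relation.Binary.Permutation.Propositional
  using (_↭_; ↭-sym; swap; ↭-refl; ↭⇒↭ₛ)
open import Data.List.Relation.Binary.Permutation.Propositional.Properties
  using (∈-resp-↭; ++⁺ˡ)
open import Data.List.Relation.Binary.Permutation.Setoid.Properties using (Unique-resp-↭)
open import Data.List.Relation.Unary.All as All using ()
open import Data.List.Relation.Unary.AllPairs using ([]; _∷_)
open import Data.List.Relation.Unary.Any using (here; there)
open import Data.List.Relation.Unary.Unique.Propositional using (Unique)
open import Data.List.Relation.Unary.Unique.Propositional.Properties using (allFin⁺)
open import Data.Nat using (ℕ; zero; suc; _+_; _*_; _≤_; z≤n; s≤s)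
open import Data.Nat.Properties hiding (_≟_)
open import Data.Nat.Tactic.RingSolver using (solve-∀)
open import Data.Product using (∃; _×_; _,_; proj₂)
open import Data.Sum using (_⊎_; inj₁; inj₂)
open import Function using (_∘_)
open import Relation.Binary.PropositionalEquality
  using (_≡_; _≢_; refl; sym; trans; cong; setoid)
open import Relation.Nullary using (yes; no; contradiction)
open import Relation.Nullary.Decidable using (¬?)

open ≤-Reasoning

private
  variable
    p ℓ c : ℕ
    x y z : Fin ℓ
    L L′ M : List (Fin ℓ)

-- Length of a duplicate-free list

lookup-injective : {A : Set} {xs : List A} → Unique xs →
                   ∀ {i j} → lookup xs i ≡ lookup xs j → i ≡ j
lookup-injective (_ ∷ _)  {zero}  {zero}  _  = refl
lookup-injective (x∉ ∷ _) {zero}  {suc j} eq =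
  contradiction eq (All.lookup x∉ (∈-lookup j))
lookup-injective (x∉ ∷ _) {suc i} {zero}  eq =
  contradiction (sym eq) (All.lookup x∉ (∈-lookup i))
lookup-injective (_ ∷ u)  {suc i} {suc j} eq = cong suc (lookup-injective u eq)

-- Bounds the number of requests in a group: they come from distinct processes.
Unique⇒length≤ : {xs : List (Fin p)} → Unique xs → length xs ≤ p
Unique⇒length≤ u = injective⇒≤ (lookup-injective u)

-- Prefixes, removals and inversions

before : Fin ℓ → List (Fin ℓ) → ℕ
before x L = length (takeWhile (λ y → ¬? (y ≟ x)) L)

-- `moveToFront x L` computes to `x ∷ remove x L`, just as `position x L` computes to
-- `suc (before x L)`.
remove : Fin ℓ → List (Fin ℓ) → List (Fin ℓ)
remove x L = filter (λ y → ¬? (y ≟ x)) L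

-- For two arrangements of the same items this is the number of inversions: when the
-- items preceding x in D have been removed from L, the items before x in the rest of
-- L are those that precede x in L and follow it in D.
inversions : List (Fin ℓ) → List (Fin ℓ) → ℕ
inversions []      L = 0
inversions (x ∷ D) L = before x L + inversions D (remove x L)

before-here : (x : Fin ℓ) (L : List (Fin ℓ)) → before x (x ∷ L) ≡ 0
before-here x L with x ≟ x
... | yes _  = refl
... | no x≢x = contradiction refl x≢x

before-there : (L : List (Fin ℓ)) → z ≢ x → before x (z ∷ L) ≡ suc (before x L)
before-there {z = z} {x = x} L z≢x with z ≟ x
... | yes z≡x = contradiction z≡x z≢x
... | no _    = refl

remove-here : (x : Fin ℓ) (L : List (Fin ℓ)) → remove x (x ∷ L) ≡ remove x L
remove-here x L = filter-reject (λ y → ¬? (y ≟ x)) (λ x≢x → x≢x refl)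

remove-there : (L : List (Fin ℓ)) → z ≢ x → remove x (z ∷ L) ≡ z ∷ remove x L
remove-there {x = x} L z≢x = filter-accept (λ y → ¬? (y ≟ x)) z≢x

remove-idem : (x : Fin ℓ) (L : List (Fin ℓ)) → remove x (remove x L) ≡ remove x L
remove-idem x = filter-idem (λ y → ¬? (y ≟ x))

remove-comm : (x y : Fin ℓ) (L : List (Fin ℓ)) →
              remove x (remove y L) ≡ remove y (remove x L)
remove-comm x y []      = refl
remove-comm x y (z ∷ L) with z ≟ x in eqx | z ≟ y in eqy
... | yes _ | yes _ = remove-comm x y L
... | yes _ | no _  rewrite eqx = remove-comm x y L
... | no _  | yes _ rewrite eqy = remove-comm x y L
... | no _  | no _  rewrite eqx | eqy = cong (z ∷_) (remove-comm x y L)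

before-remove : (L : List (Fin ℓ)) → y ≢ x → before x (remove y L) ≤ before x L
before-remove                 []      y≢x = z≤n
before-remove {y = y} {x = x} (z ∷ L) y≢x with z ≟ y
... | yes refl rewrite before-there L y≢x = m≤n⇒m≤1+n (before-remove L y≢x)
... | no _ with z ≟ x
...   | yes _ = z≤n
...   | no _  = s≤s (before-remove L y≢x)

-- Whichever of `x` and `y` is met first in `L` is counted in the prefix of the other, so deleting
-- it shortens that prefix.
removal-shortens : y ≢ x → x ∈ L →
  (suc (before x (remove y L)) ≤ before x L × before y (remove x L) ≤ before y L) ⊎
  (before x (remove y L) ≤ before x L × suc (before y (remove x L)) ≤ before y L)
removal-shortens {y = y} {x = x} {L = z ∷ L} y≢x x∈L with z ≟ x in eqx | z ≟ y in eqy
... | yes refl | yes refl = contradiction refl y≢x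
... | yes refl | no _     rewrite eqx = inj₂ (z≤n , s≤s (before-remove L (y≢x ∘ sym)))
... | no _     | yes refl rewrite eqy = inj₁ (s≤s (before-remove L y≢x) , z≤n)
... | no z≢x   | no _     rewrite eqx | eqy with x∈L
...   | here x≡z   = contradiction (sym x≡z) z≢x
...   | there x∈L′ with removal-shortens y≢x x∈L′
...     | inj₁ (h , h′) = inj₁ (s≤s h , s≤s h′)
...     | inj₂ (h , h′) = inj₂ (s≤s h , s≤s h′)

-- The hypothesis says that `x` is absent from `L`, so deleting `x` from `D` drops its own summands
-- and leaves the others as they are.
inversions-remove : ∀ D → remove x L ≡ L → inversions (remove x D) L ≤ inversions D L
inversions-remove                 []      _  = z≤n
inversions-remove {x = x} {L = L} (y ∷ D) eq with y ≟ x
... | yes refl rewrite eq = m≤n⇒m≤o+n (before x L) (inversions-remove D eq)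
... | no _     =
  +-monoʳ-≤ (before y L)
    (inversions-remove D (trans (remove-comm x y L) (cong (remove y) eq)))

-- Induction along `D` up to `x`: each `y` in front of `x` costs `r`, which `removal-shortens`
-- charges either to the prefix of `x` in `L` or to a vanishing inversion.
moveToFront-amortized : ∀ {r} → r ≤ p → ∀ D → x ∈ L →
  r * before x D + p * inversions (remove x D) (remove x L)
    ≤ r * before x L + p * inversions D L
moveToFront-amortized {p = p} {r = r} r≤p [] _ rewrite *-zeroʳ r | *-zeroʳ p = z≤n
moveToFront-amortized {p = p} {x = x} {L = L} {r = r} r≤p (y ∷ D) x∈L with y ≟ x
... | yes refl = begin
  r * 0 + p * inversions (remove x D) (remove x L)
    ≡⟨ cong (_+ p * inversions (remove x D) (remove x L)) (*-zeroʳ r) ⟩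
  p * inversions (remove x D) (remove x L)
    ≤⟨ *-monoʳ-≤ p (inversions-remove D (remove-idem x L)) ⟩
  p * inversions D (remove x L)
    ≤⟨ *-monoʳ-≤ p (m≤n+m _ (before x L)) ⟩
  p * (before x L + inversions D (remove x L))
    ≤⟨ m≤n+m _ (r * before x L) ⟩
  r * before x L + p * (before x L + inversions D (remove x L))
    ∎
... | no y≢x = begin
  r * suc (before x D) + p * (before y (remove x L) + inversions D′ (remove y (remove x L)))
    ≡⟨ cong (λ N → r * suc (before x D) + p * (before y (remove x L) + inversions D′ N))
            (remove-comm y x L) ⟩
  r * suc (before x D) + p * (before y (remove x L) + inversions D′ (remove x (remove y L)))
    ≡⟨ split r p (before x D) (before y (remove x L)) _ ⟩
  (r + p * before y (remove x L)) + (r * before x D + p * inversions D′ (remove x (remove y L)))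
    ≤⟨ +-monoʳ-≤ (r + p * before y (remove x L)) (moveToFront-amortized r≤p D
         (∈-filter⁺ (λ z → ¬? (z ≟ y)) x∈L (y≢x ∘ sym))) ⟩
  (r + p * before y (remove x L)) + (r * before x (remove y L) + p * inversions D (remove y L))
    ≡⟨ +-assoc (r + _) _ _ ⟨
  (r + p * before y (remove x L) + r * before x (remove y L)) + p * inversions D (remove y L)
    ≤⟨ +-monoˡ-≤ _ (exchange-pair (removal-shortens y≢x x∈L)) ⟩
  (r * before x L + p * before y L) + p * inversions D (remove y L)
    ≡⟨ merge r p (before x L) (before y L) _ ⟩
  r * before x L + p * (before y L + inversions D (remove y L))
    ∎
  where
  D′ = remove x D

  split : ∀ r p a b i → r * suc a + p * (b + i) ≡ (r + p * b) + (r * a + p * i)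
  split = solve-∀

  merge : ∀ r p a b i → (r * a + p * b) + p * i ≡ r * a + p * (b + i)
  merge = solve-∀

  swap₁ : ∀ r p a b → r + p * b + r * a ≡ r * suc a + p * b
  swap₁ = solve-∀

  swap₂ : ∀ r p a b → p + p * b + r * a ≡ r * a + p * suc b
  swap₂ = solve-∀

  -- In the first case `y` is met before `x` in `L` too, and `r * before x L` absorbs the charge
  -- `r`. In the second, the inversion of `x` and `y` disappears and releases `p`, which is at least
  -- `r`.
  exchange-pair : ∀ {a a′ b b′} → (suc a ≤ a′ × b ≤ b′) ⊎ (a ≤ a′ × suc b ≤ b′) →
                  r + p * b + r * a ≤ r * a′ + p * b′
  exchange-pair {a} {b = b} (inj₁ (a<a′ , b≤b′)) =
    ≤-trans (≤-reflexive (swap₁ r p a b)) (+-mono-≤ (*-monoʳ-≤ r a<a′) (*-monoʳ-≤ p b≤b′))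
  exchange-pair {a} {b = b} (inj₂ (a≤a′ , b<b′)) =
    ≤-trans (+-monoˡ-≤ (r * a) (+-monoˡ-≤ (p * b) r≤p))
      (≤-trans (≤-reflexive (swap₂ r p a b))
        (+-mono-≤ (*-monoʳ-≤ r a≤a′) (*-monoʳ-≤ p b<b′)))

inversions-refl : Unique L → inversions L L ≡ 0
inversions-refl []                      = refl
inversions-refl {L = x ∷ L} (x∉L ∷ u)
  rewrite before-here x L | remove-here x L
        | filter-all (λ y → ¬? (y ≟ x)) (All.map (_∘ sym) x∉L) = inversions-refl u

-- Effect of OPT's moves on prefixes and inversions

Exchange-∷ : ∀ z → Exchange L L′ → Exchange (z ∷ L) (z ∷ L′)
Exchange-∷ z (exchange as x y bs) = exchange (z ∷ as) x y bs

Exchange⇒↭ : Exchange L L′ → L ↭ L′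
Exchange⇒↭ (exchange as x y bs) = ++⁺ˡ as (swap x y ↭-refl)

-- The split is on whether `z` belongs to the swapped pair. If so, deleting `z` hides the swap; if
-- not, the swap survives the deletion and the prefix of `z` keeps its length.
exchange-cases : ∀ z → Exchange L L′ →
  (remove z L ≡ remove z L′ × before z L ≤ suc (before z L′)) ⊎
  (Exchange (remove z L) (remove z L′) × before z L ≡ before z L′)
exchange-cases z (exchange [] x y bs) with x ≟ z in eqx | y ≟ z in eqy
... | yes refl | yes refl rewrite eqx = inj₁ (refl , z≤n)
... | yes refl | no _     rewrite eqx | eqy = inj₁ (refl , z≤n)
... | no _     | yes refl rewrite eqx | eqy = inj₁ (refl , ≤-refl)
... | no _     | no _     rewrite eqx | eqy = inj₂ (exchange [] x y (remove z bs) , refl)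
exchange-cases z (exchange (a ∷ as) x y bs)
  with exchange-cases z (exchange as x y bs) | a ≟ z
... | inj₁ (eq , _) | yes _ = inj₁ (eq , z≤n)
... | inj₁ (eq , h) | no _  = inj₁ (cong (a ∷_) eq , s≤s h)
... | inj₂ (e , _)  | yes _ = inj₂ (e , refl)
... | inj₂ (e , eq) | no _  = inj₂ (Exchange-∷ a e , cong suc eq)

Exchange-sym : Exchange L L′ → Exchange L′ L
Exchange-sym (exchange as x y bs) = exchange as y x bs

-- Summands agree until `D` reaches an item of the swapped pair. That summand differs by at most
-- one, and removing the item makes the two lists equal.
inversions-exchange : ∀ D → Exchange L L′ → inversions D L ≤ suc (inversions D L′)
inversions-exchange          []      e = z≤n
inversions-exchange {L′ = L′} (x ∷ D) e with exchange-cases x e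
... | inj₁ (eq , h) rewrite eq = +-monoˡ-≤ (inversions D (remove x L′)) h
... | inj₂ (e′ , eq) rewrite eq =
  ≤-trans (+-monoʳ-≤ (before x L′) (inversions-exchange D e′))
          (≤-reflexive (+-suc (before x L′) _))

-- A free move relocates `x` alone, so an access to `x` preserves the inversions among the other
-- items.
forward-remove : Forward x L L′ → remove x L ≡ remove x L′
forward-remove {x = x} (forward as as′ bs)
  rewrite filter-++ (λ y → ¬? (y ≟ x)) as (as′ ++ x ∷ bs)
        | filter-++ (λ y → ¬? (y ≟ x)) as′ (x ∷ bs)
        | filter-++ (λ y → ¬? (y ≟ x)) as (x ∷ as′ ++ bs)
        | remove-here x bs | remove-here x (as′ ++ bs)
        | filter-++ (λ y → ¬? (y ≟ x)) as′ bs = refl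

forward-before : Forward x L L′ → before x L′ ≤ before x L
forward-before {x = x} (forward as as′ bs) = go as
  where
  go : ∀ as → before x (as ++ x ∷ as′ ++ bs) ≤ before x (as ++ as′ ++ x ∷ bs)
  go [] rewrite before-here x (as′ ++ bs) = z≤n
  go (a ∷ as) with a ≟ x
  ... | yes _ = z≤n
  ... | no _  = s≤s (go as)

served⇒∈ : Serves L (x ∷ M) c → x ∈ L
served⇒∈ (paid e s)                     = ∈-resp-↭ (↭-sym (Exchange⇒↭ e)) (served⇒∈ s)
served⇒∈ (access (forward as as′ bs) s) = ∈-++⁺ʳ as (∈-++⁺ʳ as′ (here refl))

-- Amortized comparison along OPT's schedule

mutual

  betweenGroups : ∀ (gs : List (Group p ℓ)) D → Serves L (map proj₂ (linearize gs)) c →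
    groupsCost D gs ≤ (p + 1) * c + p * inversions D L
  betweenGroups [] D s = z≤n
  betweenGroups {p = p} {L = L} {c = c}
                (record { item = x ; processes = i ∷ is ; distinct = u } ∷ gs) D s =
    -- `moveToFront-amortized` leaves `p * I` on the smaller side and `withinGroup` on the larger
    -- one, so it is added to both and cancelled.
    +-cancelʳ-≤ (p * I) _ _ (begin
      r * suc (before x D) + G + p * I
        ≡⟨ cost-first r (before x D) G (p * I) ⟩
      (r * before x D + p * I) + (r + G)
        ≤⟨ +-monoˡ-≤ (r + G) (moveToFront-amortized r≤p D (served⇒∈ s)) ⟩
      (r * before x L + p * J) + (r + G)
        ≡⟨ cost-first r (before x L) G (p * J) ⟨
      r * position x L + G + p * J
        ≤⟨ +-monoˡ-≤ (p * J) (withinGroup x is gs D r≤p s) ⟩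
      (p + 1) * c + p * I + p * J
        ≡⟨ +-comm-last ((p + 1) * c) (p * I) (p * J) ⟩
      (p + 1) * c + p * J + p * I
        ∎)
    where
    r = suc (length is)
    G = groupsCost (moveToFront x D) gs
    I = inversions (remove x D) (remove x L)
    J = inversions D L

    r≤p : r ≤ p
    r≤p = Unique⇒length≤ u

    cost-first : ∀ r b g i → r * suc b + g + i ≡ (r * b + i) + (r + g)
    cost-first = solve-∀

    +-comm-last : ∀ a b c → a + b + c ≡ a + c + b
    +-comm-last = solve-∀

  -- Induction on OPT's schedule. The debt is expressed by the current position of `x` in OPT's
  -- list, so that it follows the paid exchanges; `D` remains DMTF's list from before the group.
  withinGroup : ∀ x (is : List (Fin p)) (gs : List (Group p ℓ)) D → suc (length is) ≤ p →
    Serves L (x ∷ map proj₂ (map (_, x) is ++ linearize gs)) c →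
    suc (length is) * position x L + groupsCost (moveToFront x D) gs
      ≤ (p + 1) * c + p * inversions (remove x D) (remove x L)
  withinGroup {p = p} {L = L} x is gs D r≤p (paid {L′ = L′} {c = c} e s)
    with exchange-cases x e
  -- The exchange involves `x`: the counted inversions stay, and the debt changes by at most `r`,
  -- covered by `p + 1`.
  ... | inj₁ (eq , h) rewrite eq = begin
    r * position x L + G
      ≤⟨ +-monoˡ-≤ G (*-monoʳ-≤ r (s≤s h)) ⟩
    r * suc (position x L′) + G
      ≡⟨ cong (_+ G) (*-suc r (position x L′)) ⟩
    r + r * position x L′ + G
      ≡⟨ +-assoc r _ G ⟩
    r + (r * position x L′ + G)
      ≤⟨ +-mono-≤ (m≤n⇒m≤n+o 1 r≤p) (withinGroup x is gs D r≤p s) ⟩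
    (p + 1) + ((p + 1) * c + p * inversions (remove x D) (remove x L′))
      ≡⟨ cost-paid p c _ ⟩
    (p + 1) * suc c + p * inversions (remove x D) (remove x L′)
      ∎
    where
    r = suc (length is)
    G = groupsCost (moveToFront x D) gs

    cost-paid : ∀ p c i → (p + 1) + ((p + 1) * c + p * i) ≡ (p + 1) * suc c + p * i
    cost-paid = solve-∀
  -- The exchange avoids `x`: the debt stays, and at most one new inversion has to be paid for, at
  -- price `p`.
  ... | inj₂ (e′ , eq) rewrite eq = begin
    r * position x L′ + G
      ≤⟨ withinGroup x is gs D r≤p s ⟩
    (p + 1) * c + p * inversions (remove x D) (remove x L′)
      ≤⟨ +-monoʳ-≤ ((p + 1) * c)
           (*-monoʳ-≤ p (inversions-exchange (remove x D) (Exchange-sym e′))) ⟩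
    (p + 1) * c + p * suc I
      ≤⟨ n≤1+n _ ⟩
    suc ((p + 1) * c + p * suc I)
      ≡⟨ cost-paid p c I ⟩
    (p + 1) * suc c + p * I
      ∎
    where
    r = suc (length is)
    G = groupsCost (moveToFront x D) gs
    I = inversions (remove x D) (remove x L)

    cost-paid : ∀ p c i → suc ((p + 1) * c + p * suc i) ≡ (p + 1) * suc c + p * i
    cost-paid = solve-∀
  -- Last request of the group: one share of `suc b` settles the debt. The other `p` shares restore
  -- the inversions with `x`, which number `before x L′` because `x` now heads DMTF's list.
  withinGroup {p = p} {L = L} x [] gs D r≤p (access {L′ = L′} {c = c} f s) = begin
    1 * suc b + G
      ≤⟨ +-monoʳ-≤ (1 * suc b) (betweenGroups gs (moveToFront x D) s) ⟩
    1 * suc b + ((p + 1) * c + p * (before x L′ + inversions (remove x D) (remove x L′)))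
      ≡⟨ cong (λ N → 1 * suc b + ((p + 1) * c + p * (before x L′ + inversions (remove x D) N)))
              (forward-remove f) ⟨
    1 * suc b + ((p + 1) * c + p * (before x L′ + I))
      ≤⟨ +-monoʳ-≤ (1 * suc b) (+-monoʳ-≤ ((p + 1) * c)
           (*-monoʳ-≤ p (+-monoˡ-≤ I (m≤n⇒m≤1+n (forward-before f))))) ⟩
    1 * suc b + ((p + 1) * c + p * (suc b + I))
      ≡⟨ cost-access p c b I ⟩
    (p + 1) * (suc b + c) + p * I
      ∎
    where
    b = before x L
    G = groupsCost (moveToFront x D) gs
    I = inversions (remove x D) (remove x L)

    cost-access : ∀ p c b i →
      1 * suc b + ((p + 1) * c + p * (suc b + i)) ≡ (p + 1) * (suc b + c) + p * i
    cost-access = solve-∀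
  -- This access pays the whole debt; the debt term in the induction hypothesis is then mere slack.
  withinGroup {p = p} {L = L} x (_ ∷ is) gs D r≤p (access {L′ = L′} {c = c} f s) = begin
    r * position x L + G
      ≤⟨ +-mono-≤ (*-monoˡ-≤ (position x L) (m≤n⇒m≤n+o 1 r≤p)) (m≤n+m G _) ⟩
    (p + 1) * position x L + (suc (length is) * position x L′ + G)
      ≤⟨ +-monoʳ-≤ ((p + 1) * position x L) (withinGroup x is gs D (<⇒≤ r≤p) s) ⟩
    (p + 1) * position x L + ((p + 1) * c + p * inversions (remove x D) (remove x L′))
      ≡⟨ cong (λ N → (p + 1) * position x L + ((p + 1) * c + p * inversions (remove x D) N))
              (forward-remove f) ⟨
    (p + 1) * position x L + ((p + 1) * c + p * I)
      ≡⟨ +-assoc ((p + 1) * position x L) _ (p * I) ⟨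
    (p + 1) * position x L + (p + 1) * c + p * I
      ≡⟨ cong (_+ p * I) (*-distribˡ-+ (p + 1) (position x L) c) ⟨
    (p + 1) * (position x L + c) + p * I
      ∎
    where
    r = suc (suc (length is))
    G = groupsCost (moveToFront x D) gs
    I = inversions (remove x D) (remove x L)

theorem39 : (p ℓ : ℕ) → 1 ≤ p → 1 ≤ ℓ →
    ∃ λ (α : ℕ) →
    (L₀ : Order ℓ) (σ : Fin p → List (Fin ℓ)) (ε : Execution σ) →
    DMTF L₀ ε ≤ (p + 1) * OPT L₀ (Lin ε) + α
theorem39 p ℓ _ _ = 0 , λ L₀ σ ε →
  let c , s , _ = optimum L₀ (Lin ε)
      u = Unique-resp-↭ (setoid _) (↭⇒↭ₛ (↭-sym (arrangement L₀))) (allFin⁺ ℓ)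
  in begin
  DMTF L₀ ε
    ≤⟨ betweenGroups (groups ε) (items L₀) s ⟩
  (p + 1) * c + p * inversions (items L₀) (items L₀)
    -- The common initial list is duplicate-free, so the initial potential is zero.
    ≡⟨ cong (λ n → (p + 1) * c + p * n) (inversions-refl u) ⟩
  (p + 1) * c + p * 0
    ≡⟨ cong ((p + 1) * c +_) (*-zeroʳ p) ⟩
  (p + 1) * c + 0
    ∎
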